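{- Let $k\in\mathbb N$. Every $k$-coherent property that is definable in $\mathrm{TeamLTL}(\sim)$ is also definable in $\forall^k\mathrm{HyperLTL}$. That is, for every $k$-coherent $\mathrm{TeamLTL}(\sim)$-formula $\varphi$ there is a $\forall^k\mathrm{HyperLTL}$-formula $\psi$ such that for every set $T$ of traces and every $i\in\mathbb N$: $(T,i)\models\varphi$ iff $\emptyset,i\models_T\psi$.
   Context: A trace over a set $\mathrm{AP}$ of atomic propositions is an element of $(2^{\mathrm{AP}})^\omega$, and $t[i]$ is its $i$-th letter. A team is a pair $(T,i)$ with $T$ a set of traces and $i\in\mathbb N$. $\mathrm{TeamLTL}(\sim)$ formulae are $\varphi ::= p \mid \neg p \mid \sim\!\varphi\mid\varphi\lor\varphi \mid \varphi\land\varphi \mid \mathsf X\varphi \mid \varphi\,\mathsf U\,\varphi \mid \varphi\,\mathsf W\,\varphi$ ($p\in\mathrm{AP}$), with semantics: - $(T,i)\models p$ iff $p\in t[i]$ for all $t\in T$; $(T,i)\models\neg p$ iff $p\notin t[i]$ for all $t\in T$; - $(T,i)\models\,\sim\!\varphi$ iff $(T,i)\not\models\varphi$; - $(T,i)\models\varphi\land\psi$ iff $(T,i)\models\varphi$ and $(T,i)\models\psi$; - $(T,i)\models\varphi\lor\psi$ iff there are $T_1,T_2$ with $T_1\cup T_2=T$, $(T_1,i)\models\varphi$ and $(T_2,i)\models\psi$; - $(T,i)\models\mathsf X\varphi$ iff $(T,i+1)\models\varphi$; - $(T,i)\models\varphi\,\mathsf U\,\psi$ iff there is $n\ge i$ with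 $(T,n)\models\psi$ and $(T,m)\models\varphi$ for all $i\le m<n$; - $(T,i)\models\varphi\,\mathsf W\,\psi$ iff for all $n\ge i$: $(T,n)\models\varphi$ or there is $m$ with $i\le m\le n$ and $(T,m)\models\psi$. A formula $\varphi$ is $k$-coherent if for every team $(T,i)$: $(T,i)\models\varphi$ iff $(S,i)\models\varphi$ for every $S\subseteq T$ with $|S|\le k$. $\forall^k\mathrm{HyperLTL}$ consists of the formulae $\forall\pi_1\dots\forall\pi_k.\,\psi$ where $\psi ::= p_\pi\mid\neg p_\pi\mid\psi\lor\psi\mid\psi\land\psi\mid\mathsf X\psi\mid\psi\,\mathsf U\,\psi\mid\psi\,\mathsf W\,\psi$ (with constants $\top,\bot$ available) and $\pi$ ranges over trace variables. Given a set $T$ of traces and an assignment $\Pi$ of traces in $T$ to trace variables: $\Pi,i\models_T p_\pi$ iff $p\in\Pi(\pi)[i]$; $\Pi,i\models_T\neg p_\pi$ iff $p\notin\Pi(\pi)[i]$; Boolean connectives and $\mathsf X,\mathsf U,\mathsf W$ are interpreted as usual in LTL with respect to the position $i$; $\Pi,i\models_T\forall\pi.\varphi$ iff $\Pi[\pi\mapsto t],i\models_T\varphi$ for all $t\in T$, where $\Pi[\pi\mapsto t]$ is $\Pi$ modified to map $\pi$ to $t$. In $\emptyset,i\models_T\psi$, $\emptyset$ denotes the empty assignment.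
   Formalization: For k ≥ 1 the equivalence is not claimed at T = ∅ when (∅,i) does not satisfy φ: there every ∀^k formula is vacuously true, so it fails for any ψ (e.g. the k-coherent φ = ∼(p ∨ ¬p)); every other (T,i) is covered. -}

module Defs where

open import Data.Bool using (Bool; true; false)
open import Data.Empty using (⊥)
open import Data.Fin using (Fin)
open import Data.List using (List; length)
open import Data.List.Membership.Propositional using () renaming (_∈_ to _∈ˡ_)
open import Data.Nat using (ℕ; zero; suc; _≤_; _<_)
open import Data.Product using (_×_; _,_; ∃-syntax)
open import Data.Sum using (_⊎_)
open import Data.Unit using (⊤)
open import Data.Vec using (Vec; []; _∷_; lookup)
open import Function.Bundles using (_⇔_)
open import Level using (Level; Lift; 0ℓ) renaming (suc to lsuc)
open import Relation.Binary.PropositionalEquality using (_≡_)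
open import Relation.Nullary using (¬_)
open import Relation.Unary using (Pred; _∪_; _⊆_; _≐_)

private variable
  AP  : Set
  k n : ℕ

Trace : Set → Set
Trace AP = ℕ → (AP → Bool)

TraceSet : Set → Set₁
TraceSet AP = Pred (Trace AP) 0ℓ

Team : Set → Set₁
Team AP = TraceSet AP × ℕ

infix 30 _∈[_,_] _∉[_,_]

_∈[_,_] : AP → Trace AP → ℕ → Set
p ∈[ t , i ] = t i p ≡ true

_∉[_,_] : AP → Trace AP → ℕ → Set
p ∉[ t , i ] = ¬ p ∈[ t , i ]

infix  9 ∼_ X_
infixr 7 _`∧_
infixr 6 _`∨_
infixr 8 _U_ _W_

data TeamLTL (AP : Set) : Set where
  pos neg             : AP → TeamLTL AP
  ∼_ X_               : TeamLTL AP → TeamLTL AP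
  _`∨_ _`∧_ _U_ _W_   : TeamLTL AP → TeamLTL AP → TeamLTL AP

infix 4 _⊨_

-- Values lie in Set₁ because `∨ quantifies over sets of traces.
_⊨_ : Team AP → TeamLTL AP → Set₁
(T , i) ⊨ pos p    = Lift (lsuc 0ℓ) (∀ t → T t → p ∈[ t , i ])
(T , i) ⊨ neg p    = Lift (lsuc 0ℓ) (∀ t → T t → p ∉[ t , i ])
(T , i) ⊨ ∼ φ      = ¬ (T , i) ⊨ φ
(T , i) ⊨ X φ      = (T , suc i) ⊨ φ
(T , i) ⊨ φ `∨ ψ   = ∃[ T₁ ] ∃[ T₂ ] (T₁ ∪ T₂ ≐ T) × (T₁ , i) ⊨ φ × (T₂ , i) ⊨ ψ
(T , i) ⊨ φ `∧ ψ   = (T , i) ⊨ φ × (T , i) ⊨ ψ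
(T , i) ⊨ φ U ψ    = ∃[ n ] i ≤ n × (T , n) ⊨ ψ × (∀ m → i ≤ m → m < n → (T , m) ⊨ φ)
(T , i) ⊨ φ W ψ    = ∀ n → i ≤ n → (T , n) ⊨ φ ⊎ (∃[ m ] i ≤ m × m ≤ n × (T , m) ⊨ ψ)

∣_∣≤_ : TraceSet AP → ℕ → Set
∣ S ∣≤ k = ∃[ ts ] length ts ≤ k × S ⊆ (_∈ˡ ts)

Coherent : ℕ → TeamLTL AP → Set₁
Coherent {AP} k φ = (T : TraceSet AP) (i : ℕ) →
  (T , i) ⊨ φ ⇔ ((S : TraceSet AP) → S ⊆ T → ∣ S ∣≤ k → (S , i) ⊨ φ)

-- Quantifier-free formulae with n trace variables in scope; variables are
-- de Bruijn indices, zero being bound by the innermost quantifier.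
data Matrix (AP : Set) (n : ℕ) : Set where
  `⊤ `⊥               : Matrix AP n
  pos neg             : AP → Fin n → Matrix AP n
  X_                  : Matrix AP n → Matrix AP n
  _`∨_ _`∧_ _U_ _W_   : Matrix AP n → Matrix AP n → Matrix AP n

-- k leading universal quantifiers, n free trace variables.
data Universal (AP : Set) : ℕ → ℕ → Set where
  matrix : Matrix AP n → Universal AP zero n
  `∀_    : Universal AP k (suc n) → Universal AP (suc k) n

∀HyperLTL : Set → ℕ → Set
∀HyperLTL AP k = Universal AP k zero

Assignment : Set → ℕ → Set
Assignment AP n = Vec (Trace AP) n

infix 4 _,_⊨ᵐ_ _,_⊨[_]_

_,_⊨ᵐ_ : Assignment AP n → ℕ → Matrix AP n → Set
Π , i ⊨ᵐ `⊤       = ⊤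
Π , i ⊨ᵐ `⊥       = ⊥
Π , i ⊨ᵐ pos p π  = p ∈[ lookup Π π , i ]
Π , i ⊨ᵐ neg p π  = p ∉[ lookup Π π , i ]
Π , i ⊨ᵐ X φ      = Π , suc i ⊨ᵐ φ
Π , i ⊨ᵐ φ `∨ ψ   = Π , i ⊨ᵐ φ ⊎ Π , i ⊨ᵐ ψ
Π , i ⊨ᵐ φ `∧ ψ   = Π , i ⊨ᵐ φ × Π , i ⊨ᵐ ψ
Π , i ⊨ᵐ φ U ψ    = ∃[ n ] i ≤ n × Π , n ⊨ᵐ ψ × (∀ m → i ≤ m → m < n → Π , m ⊨ᵐ φ)
Π , i ⊨ᵐ φ W ψ    = ∀ n → i ≤ n → Π , n ⊨ᵐ φ ⊎ (∃[ m ] i ≤ m × m ≤ n × Π , m ⊨ᵐ ψ)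

_,_⊨[_]_ : Assignment AP n → ℕ → TraceSet AP → Universal AP k n → Set
Π , i ⊨[ T ] matrix φ = Π , i ⊨ᵐ φ
Π , i ⊨[ T ] `∀ φ     = ∀ t → T t → t ∷ Π , i ⊨[ T ] φ

{-# OPTIONS --safe #-}
-- For traces t₁ … tₙ, the truth of φ on the finite team { tⱼ | j ∈ J } is
-- expressible by a quantifier-free formula: a splitting of that team is one of
-- finitely many splittings of the index list J, so team disjunction becomes a
-- finite disjunction, and ∼ is removed by passing to the dual formula.  By
-- coherence φ holds on T iff it holds on all teams { t₁ , … , tₖ } ⊆ T, and
-- this is a ∀ᵏ-statement.
module Submission where

open import Axiom.ExcludedMiddle using (ExcludedMiddle)
open import Axiom.DoubleNegationElimination using (em⇒dne)
open import Data.Bool.Properties using () renaming (_≟_ to _≟ᵇ_)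
open import Data.Empty using (⊥-elim)
open import Data.Fin using (Fin; zero; suc)
open import Data.List using (List; []; _∷_; map; filter; length; allFin)
open import Data.List.Membership.Propositional using () renaming (_∈_ to _∈ˡ_)
open import Data.List.Membership.Propositional.Properties
  using (∈-map⁺; ∈-map⁻; ∈-filter⁺; ∈-filter⁻; ∈-allFin)
open import Data.List.Properties using (length-map; length-tabulate)
open import Data.List.Relation.Unary.Any using (here; there)
open import Data.Nat using (ℕ; zero; suc; _+_; _≤_; z≤n; s≤s)
open import Data.Nat.Induction using (<-rec)
open import Data.Nat.Properties
  using (≤-refl; ≤-trans; ≤-reflexive; <⇒≤; ≤∧≢⇒<; +-suc; +-identityʳ)
open import Data.Product using (_×_; _,_; proj₂; Σ-syntax; ∃-syntax)
open import Data.Sum using (_⊎_; inj₁; inj₂; [_,_]′)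
import Data.Sum as Sum
open import Data.Vec using ([]; _∷_; lookup)
open import Function.Base using (_∘_; id)
open import Function.Bundles using (_⇔_; mk⇔; module Equivalence)
open import Level using (0ℓ; Lift; lift; lower) renaming (suc to lsuc)
open import Relation.Binary.PropositionalEquality using (_≡_; refl; sym; trans; subst)
open import Relation.Nullary using (¬_; yes; no; contradiction)
open import Relation.Nullary.Decidable using (decidable-stable; map′)
open import Relation.Unary using (∅; Satisfiable; Pred; Decidable; _∪_; _⊆_; _≐_)
open import Relation.Unary.Properties using (≐-trans; ≐-sym)
open import Defs

open Equivalence using (to; from)

private variable
  A AP : Set
  n    : ℕ
  Π    : Assignment AP n
  T    : TraceSet AP

-- Sets of traces are predicates, so a part of a splitting and the team of an index list can be
-- compared only by mutual inclusion. This lets satisfaction move between them.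
⊨-resp-≐ : {T T′ : TraceSet AP} (φ : TeamLTL AP) {i : ℕ} →
           T ≐ T′ → (T , i) ⊨ φ → (T′ , i) ⊨ φ
⊨-resp-≐ (pos p)  eq (lift h) = lift λ t t∈ → h t (proj₂ eq t∈)
⊨-resp-≐ (neg p)  eq (lift h) = lift λ t t∈ → h t (proj₂ eq t∈)
⊨-resp-≐ (∼ φ)    eq h = h ∘ ⊨-resp-≐ φ (≐-sym eq)
⊨-resp-≐ (X φ)    eq h = ⊨-resp-≐ φ eq h
⊨-resp-≐ (φ `∨ ψ) eq (T₁ , T₂ , split , h₁ , h₂) = T₁ , T₂ , ≐-trans split eq , h₁ , h₂
⊨-resp-≐ (φ `∧ ψ) eq (h₁ , h₂) = ⊨-resp-≐ φ eq h₁ , ⊨-resp-≐ ψ eq h₂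
⊨-resp-≐ (φ U ψ)  eq (n , i≤n , h , hs) =
  n , i≤n , ⊨-resp-≐ ψ eq h , λ m i≤m m<n → ⊨-resp-≐ φ eq (hs m i≤m m<n)
⊨-resp-≐ (φ W ψ)  eq h n i≤n =
  Sum.map (⊨-resp-≐ φ eq) (λ (m , i≤m , m≤n , x) → m , i≤m , m≤n , ⊨-resp-≐ ψ eq x) (h n i≤n)

-- Negation of quantifier-free formulae.

dual : Matrix AP n → Matrix AP n
dual `⊤        = `⊥
dual `⊥        = `⊤
dual (pos p π) = neg p π
dual (neg p π) = pos p π
dual (X a)     = X dual a
dual (a `∨ b)  = dual a `∧ dual b
dual (a `∧ b)  = dual a `∨ dual b
-- An until fails when `b` fails forever, or up to and including a position where `a` fails as well.
-- Neither `U` nor `W` asks its left argument at the position of its right one, hence the conjunct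
-- `dual b` there.
dual (a U b)   = dual b W (dual a `∧ dual b)
dual (a W b)   = dual b U (dual a `∧ dual b)

dual-contradicts : (a : Matrix AP n) {i : ℕ} → Π , i ⊨ᵐ dual a → ¬ (Π , i ⊨ᵐ a)
dual-contradicts (pos p π) h x = h x
dual-contradicts (neg p π) h x = x h
dual-contradicts (X a)     h x = dual-contradicts a h x
dual-contradicts (a `∨ b)  (h₁ , h₂) = [ dual-contradicts a h₁ , dual-contradicts b h₂ ]′
dual-contradicts (a `∧ b)  h (x , y) =
  [ (λ h₁ → dual-contradicts a h₁ x) , (λ h₂ → dual-contradicts b h₂ y) ]′ h
dual-contradicts {Π = Π} (a U b) h (n , i≤n , y , xs) with h n i≤n
... | inj₁ h₂ = dual-contradicts b h₂ y
-- Both `a` and `b` fail at `m`. As `b` holds at `n`, `m` is strictly earlier, and there the until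
-- demands `a`.
... | inj₂ (m , i≤m , m≤n , h₁ , h₂) =
  dual-contradicts a h₁ (xs m i≤m (≤∧≢⇒< m≤n λ m≡n →
    dual-contradicts b h₂ (subst (λ l → Π , l ⊨ᵐ b) (sym m≡n) y)))
dual-contradicts {Π = Π} (a W b) (n , i≤n , (h₁ , h₂) , hs) x with x n i≤n
... | inj₁ y = dual-contradicts a h₁ y
... | inj₂ (m , i≤m , m≤n , y) = dual-contradicts b (hs m i≤m (≤∧≢⇒< m≤n λ m≡n →
  dual-contradicts b h₂ (subst (λ l → Π , l ⊨ᵐ b) m≡n y))) y

module Classical (em : ExcludedMiddle 0ℓ) where

  dual-complete : (a : Matrix AP n) {i : ℕ} → ¬ (Π , i ⊨ᵐ a) → Π , i ⊨ᵐ dual a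
  dual-complete `⊤        h = h _
  dual-complete `⊥        h = _
  dual-complete (pos p π) h = h
  dual-complete (neg p π) h = decidable-stable (_ ≟ᵇ _) h
  dual-complete (X a)     h = dual-complete a h
  dual-complete (a `∨ b)  h = dual-complete a (h ∘ inj₁) , dual-complete b (h ∘ inj₂)
  dual-complete {Π = Π} (a `∧ b) {i} h with em {Π , i ⊨ᵐ a}
  ... | yes x = inj₂ (dual-complete b λ y → h (x , y))
  ... | no ¬x = inj₁ (dual-complete a ¬x)
  dual-complete {Π = Π} (a U b) {i} h n i≤n
    -- Decide whether a common failure of `a` and `b` occurs by position `n`: if so it releases the
    -- weak until, and if not `b` must fail at `n` itself.
    with em {∃[ m ] i ≤ m × m ≤ n × ¬ (Π , m ⊨ᵐ a) × ¬ (Π , m ⊨ᵐ b)}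
  ... | yes (m , i≤m , m≤n , ¬x , ¬y) =
    inj₂ (m , i≤m , m≤n , dual-complete a ¬x , dual-complete b ¬y)
  ... | no ¬∃ = inj₁ (dual-complete b (b-fails n i≤n ≤-refl))
    where
    b-fails : ∀ m → i ≤ m → m ≤ n → ¬ (Π , m ⊨ᵐ b)
    -- If `b` held at `m` while failing at all earlier positions from `i` on, then `a` would hold at
    -- those positions, as no common failure exists, and `m` would witness the until.
    b-fails = <-rec _ λ m rec i≤m m≤n y →
      h (m , i≤m , y , λ l i≤l l<m →
        let l≤n = ≤-trans (<⇒≤ l<m) m≤n
        in em⇒dne em λ ¬x → ¬∃ (l , i≤l , l≤n , ¬x , rec l<m i≤l l≤n))
  -- The position `n` refuting the weak until is the witness: `a` fails at `n`, and `b` fails from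
  -- `i` up to and including `n`.
  dual-complete {Π = Π} (a W b) {i} h = em⇒dne em λ ¬until →
    h λ n i≤n → em⇒dne em λ ¬x → ¬until
      ( n , i≤n
      , (dual-complete a (¬x ∘ inj₁) , dual-complete b (λ y → ¬x (inj₂ (n , i≤n , ≤-refl , y))))
      , λ m i≤m m<n → dual-complete b λ y → ¬x (inj₂ (m , i≤m , <⇒≤ m<n , y)) )

-- Finite conjunctions, and disjunctions over the coverings of a list.

⋀ : List A → (A → Matrix AP n) → Matrix AP n
⋀ []       f = `⊤
⋀ (x ∷ xs) f = f x `∧ ⋀ xs f

⋀⁺ : {f : A → Matrix AP n} {i : ℕ} (xs : List A) →
     (∀ x → x ∈ˡ xs → Π , i ⊨ᵐ f x) → Π , i ⊨ᵐ ⋀ xs f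
⋀⁺ []       h = _
⋀⁺ (x ∷ xs) h = h x (here refl) , ⋀⁺ xs (λ y → h y ∘ there)

⋀⁻ : {f : A → Matrix AP n} {i : ℕ} {xs : List A} {x : A} →
     Π , i ⊨ᵐ ⋀ xs f → x ∈ˡ xs → Π , i ⊨ᵐ f x
⋀⁻ (h , _)  (here refl) = h
⋀⁻ (_ , hs) (there x∈)  = ⋀⁻ hs x∈

-- The case `both` reflects that the two halves of a team may overlap. Since `∼` destroys downward
-- closure, overlapping splittings cannot be reduced to disjoint ones.
data Cover {A : Set} : List A → List A → List A → Set where
  []    : Cover [] [] []
  left  : ∀ {xs ys zs} x → Cover xs ys zs → Cover (x ∷ xs) (x ∷ ys) zs
  right : ∀ {xs ys zs} x → Cover xs ys zs → Cover (x ∷ xs) ys (x ∷ zs)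
  both  : ∀ {xs ys zs} x → Cover xs ys zs → Cover (x ∷ xs) (x ∷ ys) (x ∷ zs)

Cover-⊎ : ∀ {xs ys zs : List A} {x} → Cover xs ys zs → x ∈ˡ xs → x ∈ˡ ys ⊎ x ∈ˡ zs
Cover-⊎ (left  _ c) (here eq)  = inj₁ (here eq)
Cover-⊎ (left  _ c) (there x∈) = Sum.map₁ there (Cover-⊎ c x∈)
Cover-⊎ (right _ c) (here eq)  = inj₂ (here eq)
Cover-⊎ (right _ c) (there x∈) = Sum.map₂ there (Cover-⊎ c x∈)
Cover-⊎ (both  _ c) (here eq)  = inj₁ (here eq)
Cover-⊎ (both  _ c) (there x∈) = Sum.map there there (Cover-⊎ c x∈)

Cover-⊆ˡ : ∀ {xs ys zs : List A} {x} → Cover xs ys zs → x ∈ˡ ys → x ∈ˡ xs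
Cover-⊆ˡ (left  _ c) (here eq)  = here eq
Cover-⊆ˡ (left  _ c) (there x∈) = there (Cover-⊆ˡ c x∈)
Cover-⊆ˡ (right _ c) x∈         = there (Cover-⊆ˡ c x∈)
Cover-⊆ˡ (both  _ c) (here eq)  = here eq
Cover-⊆ˡ (both  _ c) (there x∈) = there (Cover-⊆ˡ c x∈)

Cover-sym : ∀ {xs ys zs : List A} → Cover xs ys zs → Cover xs zs ys
Cover-sym []          = []
Cover-sym (left  x c) = right x (Cover-sym c)
Cover-sym (right x c) = left x (Cover-sym c)
Cover-sym (both  x c) = both x (Cover-sym c)

Cover-filter : {P Q : Pred A 0ℓ} (P? : Decidable P) (Q? : Decidable Q) (xs : List A) →
               (∀ {x} → x ∈ˡ xs → P x ⊎ Q x) → Cover xs (filter P? xs) (filter Q? xs)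
Cover-filter P? Q? []       h = []
Cover-filter P? Q? (x ∷ xs) h with P? x | Q? x | Cover-filter P? Q? xs (h ∘ there)
... | yes _ | yes _ | c = both x c
... | yes _ | no  _ | c = left x c
... | no  _ | yes _ | c = right x c
... | no ¬p | no ¬q | c = ⊥-elim ([ ¬p , ¬q ]′ (h (here refl)))

-- The three choices for each entry are absorbed into the function argument, so the end of the list
-- is reached with a disjunction over all coverings and no list of coverings is ever built.
⋁Cover : List A → (List A → List A → Matrix AP n) → Matrix AP n
⋁Cover []       f = f [] []
⋁Cover (x ∷ xs) f =
  ⋁Cover xs λ ys zs → f (x ∷ ys) zs `∨ f ys (x ∷ zs) `∨ f (x ∷ ys) (x ∷ zs)

⋁Cover⁺ : {f : List A → List A → Matrix AP n} {i : ℕ} {xs ys zs : List A} →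
          Cover xs ys zs → Π , i ⊨ᵐ f ys zs → Π , i ⊨ᵐ ⋁Cover xs f
⋁Cover⁺ []          h = h
⋁Cover⁺ (left  x c) h = ⋁Cover⁺ c (inj₁ h)
⋁Cover⁺ (right x c) h = ⋁Cover⁺ c (inj₂ (inj₁ h))
⋁Cover⁺ (both  x c) h = ⋁Cover⁺ c (inj₂ (inj₂ h))

⋁Cover⁻ : {f : List A → List A → Matrix AP n} {i : ℕ} (xs : List A) →
          Π , i ⊨ᵐ ⋁Cover xs f → ∃[ ys ] ∃[ zs ] Cover xs ys zs × Π , i ⊨ᵐ f ys zs
⋁Cover⁻ []       h = [] , [] , [] , h
⋁Cover⁻ (x ∷ xs) h with ⋁Cover⁻ xs h
... | ys , zs , c , inj₁ k        = x ∷ ys , zs     , left  x c , k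
... | ys , zs , c , inj₂ (inj₁ k) = ys     , x ∷ zs , right x c , k
... | ys , zs , c , inj₂ (inj₂ k) = x ∷ ys , x ∷ zs , both  x c , k

-- Teams named by lists of trace variables.

team : Assignment AP n → List (Fin n) → TraceSet AP
team Π J = _∈ˡ map (lookup Π) J

lookup∈team : (Π : Assignment AP n) {J : List (Fin n)} {j : Fin n} → j ∈ˡ J → team Π J (lookup Π j)
lookup∈team Π = ∈-map⁺ (lookup Π)

team-mono : (Π : Assignment AP n) {J K : List (Fin n)} → (_∈ˡ J) ⊆ (_∈ˡ K) → team Π J ⊆ team Π K
team-mono Π J⊆K t∈ with ∈-map⁻ (lookup Π) t∈
... | j , j∈ , refl = lookup∈team Π (J⊆K j∈)

team-Cover : (Π : Assignment AP n) {J K L : List (Fin n)} → Cover J K L → team Π K ∪ team Π L ≐ team Π J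
team-Cover Π {J} c = union⊆ , ⊆union
  where
  union⊆ : team Π _ ∪ team Π _ ⊆ team Π J
  union⊆ = [ team-mono Π (Cover-⊆ˡ c) , team-mono Π (Cover-⊆ˡ (Cover-sym c)) ]′
  ⊆union : team Π J ⊆ team Π _ ∪ team Π _
  ⊆union t∈ with ∈-map⁻ (lookup Π) t∈
  ... | j , j∈ , refl = Sum.map (lookup∈team Π) (lookup∈team Π) (Cover-⊎ c j∈)

-- Several indices may name the same trace. Keeping every index whose trace lies in `S` makes an
-- arbitrary subteam the team of a sublist, so splittings of teams become coverings of lists.
team-filter : (Π : Assignment AP n) {S : TraceSet AP} {J : List (Fin n)} (S? : Decidable S) →
              S ⊆ team Π J → S ≐ team Π (filter (S? ∘ lookup Π) J)
team-filter Π {S} {J} S? S⊆ = ⊆team , team⊆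
  where
  ⊆team : S ⊆ team Π (filter (S? ∘ lookup Π) J)
  ⊆team s with ∈-map⁻ (lookup Π) (S⊆ s)
  ... | j , j∈ , refl = lookup∈team Π (∈-filter⁺ (S? ∘ lookup Π) j∈ s)
  team⊆ : team Π (filter (S? ∘ lookup Π) J) ⊆ S
  team⊆ t∈ with ∈-map⁻ (lookup Π) t∈
  ... | j , j∈ , refl = proj₂ (∈-filter⁻ (S? ∘ lookup Π) {xs = J} j∈)

-- Translation of team formulae and its correctness.

translate : TeamLTL AP → List (Fin n) → Matrix AP n
translate (pos p)  J = ⋀ J (pos p)
translate (neg p)  J = ⋀ J (neg p)
translate (∼ φ)    J = dual (translate φ J)
translate (X φ)    J = X translate φ J
translate (φ `∨ ψ) J = ⋁Cover J λ K L → translate φ K `∧ translate ψ L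
translate (φ `∧ ψ) J = translate φ J `∧ translate ψ J
translate (φ U ψ)  J = translate φ J U translate ψ J
translate (φ W ψ)  J = translate φ J W translate ψ J

module _ (em : ExcludedMiddle 0ℓ) where

  open Classical em

  -- The two directions are proved by mutual recursion because `∼` exchanges them.
  translate⁺ : (φ : TeamLTL AP) (J : List (Fin n)) {i : ℕ} →
               (team Π J , i) ⊨ φ → Π , i ⊨ᵐ translate φ J
  translate⁻ : (φ : TeamLTL AP) (J : List (Fin n)) {i : ℕ} →
               Π , i ⊨ᵐ translate φ J → (team Π J , i) ⊨ φ

  translate⁺ {Π = Π} (pos p) J (lift h) = ⋀⁺ J λ j j∈ → h _ (lookup∈team Π j∈)
  translate⁺ {Π = Π} (neg p) J (lift h) = ⋀⁺ J λ j j∈ → h _ (lookup∈team Π j∈)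
  translate⁺ (∼ φ)    J h = dual-complete (translate φ J) (h ∘ translate⁻ φ J)
  translate⁺ (X φ)    J h = translate⁺ φ J h
  translate⁺ {Π = Π} (φ `∨ ψ) J (T₁ , T₂ , (∪⊆ , ⊆∪) , h₁ , h₂) =
    -- The covering lists hold the indices of the traces in `T₁` and in `T₂`, with membership
    -- decided by `em`. Every index of `J` falls into one of them since the two sets exhaust the
    -- team.
    ⋁Cover⁺ (Cover-filter _ _ J (⊆∪ ∘ lookup∈team Π))
      ( translate⁺ φ _ (⊨-resp-≐ φ (team-filter Π (λ t → em {T₁ t}) (∪⊆ ∘ inj₁)) h₁)
      , translate⁺ ψ _ (⊨-resp-≐ ψ (team-filter Π (λ t → em {T₂ t}) (∪⊆ ∘ inj₂)) h₂) )
  translate⁺ (φ `∧ ψ) J (h₁ , h₂) = translate⁺ φ J h₁ , translate⁺ ψ J h₂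
  translate⁺ (φ U ψ)  J (n , i≤n , h , hs) =
    n , i≤n , translate⁺ ψ J h , λ m i≤m m<n → translate⁺ φ J (hs m i≤m m<n)
  translate⁺ (φ W ψ)  J h n i≤n =
    Sum.map (translate⁺ φ J) (λ (m , i≤m , m≤n , x) → m , i≤m , m≤n , translate⁺ ψ J x) (h n i≤n)

  translate⁻ {Π = Π} (pos p) J {i} h = lift λ t t∈ →
    let j , j∈ , eq = ∈-map⁻ (lookup Π) t∈
    in subst (λ s → p ∈[ s , i ]) (sym eq) (⋀⁻ h j∈)
  translate⁻ {Π = Π} (neg p) J {i} h = lift λ t t∈ →
    let j , j∈ , eq = ∈-map⁻ (lookup Π) t∈
    in subst (λ s → p ∉[ s , i ]) (sym eq) (⋀⁻ h j∈)
  translate⁻ (∼ φ)    J h = dual-contradicts (translate φ J) h ∘ translate⁺ φ J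
  translate⁻ (X φ)    J h = translate⁻ φ J h
  translate⁻ {Π = Π} (φ `∨ ψ) J h =
    let K , L , c , h₁ , h₂ = ⋁Cover⁻ J h
    in team Π K , team Π L , team-Cover Π c , translate⁻ φ K h₁ , translate⁻ ψ L h₂
  translate⁻ (φ `∧ ψ) J (h₁ , h₂) = translate⁻ φ J h₁ , translate⁻ ψ J h₂
  translate⁻ (φ U ψ)  J (n , i≤n , h , hs) =
    n , i≤n , translate⁻ ψ J h , λ m i≤m m<n → translate⁻ φ J (hs m i≤m m<n)
  translate⁻ (φ W ψ)  J h n i≤n =
    Sum.map (translate⁻ φ J) (λ (m , i≤m , m≤n , x) → m , i≤m , m≤n , translate⁻ ψ J x) (h n i≤n)

-- Universal closure of the matrix.

range : Assignment AP n → TraceSet AP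
range {n = n} Π = team Π (allFin n)

lookup∈range : (Π : Assignment AP n) (j : Fin n) → range Π (lookup Π j)
lookup∈range Π j = lookup∈team Π (∈-allFin j)

range-∷ : (Π : Assignment AP n) {t s : Trace AP} → range (t ∷ Π) s → s ≡ t ⊎ range Π s
range-∷ Π {t} s∈ with ∈-map⁻ (lookup (t ∷ Π)) {xs = allFin _} s∈
... | zero  , _ , eq   = inj₁ eq
... | suc j , _ , refl = inj₂ (lookup∈range Π j)

range-weaken : (Π : Assignment AP n) {t : Trace AP} → range Π ⊆ range (t ∷ Π)
range-weaken Π {t} s∈ with ∈-map⁻ (lookup Π) s∈
... | j , _ , refl = lookup∈range (t ∷ Π) (suc j)

range-∣∣≤ : (Π : Assignment AP n) → ∣ range Π ∣≤ n
range-∣∣≤ {n = n} Π =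
  map (lookup Π) (allFin n) ,
  ≤-reflexive (trans (length-map _ (allFin n)) (length-tabulate {n = n} id)) ,
  id

-- Taking the matrix for every number of free variables avoids transporting it
-- along k + suc n ≡ suc (k + n).
close : ((m : ℕ) → Matrix AP m) → (k n : ℕ) → Universal AP k n
close f zero    n = matrix (f n)
close f (suc k) n = `∀ close f k (suc n)

-- Each quantifier adds only a member of `T` to the assignment, so the inclusion of its range in `T`
-- persists down to the matrix.
close⁺ : (f : (m : ℕ) → Matrix AP m) {i : ℕ} (k : ℕ) (Π : Assignment AP n) →
         ((Π′ : Assignment AP (k + n)) → range Π′ ⊆ T → Π′ , i ⊨ᵐ f (k + n)) →
         range Π ⊆ T → Π , i ⊨[ T ] close f k n
close⁺ f zero    Π h Π⊆T = h Π Π⊆T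
close⁺ {n = n} {T = T} f {i} (suc k) Π h Π⊆T t t∈T =
  close⁺ f k (t ∷ Π)
    (subst (λ m → (Π′ : Assignment _ m) → range Π′ ⊆ T → Π′ , i ⊨ᵐ f m) (sym (+-suc k n)) h)
    λ s∈ → [ (λ { refl → t∈T }) , Π⊆T ]′ (range-∷ Π {t} s∈)

-- A listed trace outside T cannot instantiate a quantifier; t₀ takes its place.
close⁻ : (em : ExcludedMiddle 0ℓ) (f : (m : ℕ) → Matrix AP m) {i : ℕ} (k : ℕ)
         (Π : Assignment AP n) (ts : List (Trace AP)) → length ts ≤ k →
         k ≡ 0 ⊎ Satisfiable T → Π , i ⊨[ T ] close f k n →
         ∃[ m ] Σ[ Π′ ∈ Assignment AP m ]
           (Π′ , i ⊨ᵐ f m) × range Π ⊆ range Π′ × (∀ {t} → T t → t ∈ˡ ts → range Π′ t)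
close⁻ em f zero Π [] _ _ h = _ , Π , h , id , λ _ ()
close⁻ em f (suc k) Π [] _ (inj₂ (t₀ , t₀∈T)) h =
  let m , Π′ , h′ , Π⊆ , _ = close⁻ em f k (t₀ ∷ Π) [] z≤n (inj₂ (t₀ , t₀∈T)) (h t₀ t₀∈T)
  in m , Π′ , h′ , Π⊆ ∘ range-weaken Π , λ _ ()
close⁻ {T = T} em f (suc k) Π (s ∷ ts) (s≤s len) (inj₂ (t₀ , t₀∈T)) h with em {T s}
... | yes s∈T =
  let m , Π′ , h′ , Π⊆ , ts⊆ = close⁻ em f k (s ∷ Π) ts len (inj₂ (t₀ , t₀∈T)) (h s s∈T)
  in m , Π′ , h′ , Π⊆ ∘ range-weaken Π ,
     λ { _ (here refl) → Π⊆ (lookup∈range (s ∷ Π) zero) ; t∈T (there t∈) → ts⊆ t∈T t∈ }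
... | no s∉T =
  let m , Π′ , h′ , Π⊆ , ts⊆ = close⁻ em f k (t₀ ∷ Π) ts len (inj₂ (t₀ , t₀∈T)) (h t₀ t₀∈T)
  in m , Π′ , h′ , Π⊆ ∘ range-weaken Π ,
     λ { t∈T (here refl) → contradiction t∈T s∉T ; t∈T (there t∈) → ts⊆ t∈T t∈ }

-- For positive `k` and empty `T` the universal formula holds vacuously, while `φ` may fail: an
-- unsatisfiable formula is coherent for every `k`. The three-way condition leaves out exactly the
-- case where `k` is positive, `T` is empty and `φ` fails on the empty team.
theorem9 : ExcludedMiddle (lsuc 0ℓ) →
    (AP : Set) (k : ℕ) (φ : TeamLTL AP) → Coherent k φ →
    Σ[ ψ ∈ ∀HyperLTL AP k ]
    ((T : TraceSet AP) (i : ℕ) →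
    k ≡ 0 ⊎ Satisfiable T ⊎ ((∅ , i) ⊨ φ) →
    ((T , i) ⊨ φ) ⇔ ([] , i ⊨[ T ] ψ))
theorem9 em₁ AP k φ coherent = close matrices k 0 , λ T i hyp → mk⇔ (forth T i) (back T i hyp)
  where
  em : ExcludedMiddle 0ℓ
  em {P} = map′ lower lift (em₁ {Lift _ P})

  matrices : (m : ℕ) → Matrix AP m
  matrices m = translate φ (allFin m)

  forth : ∀ T i → (T , i) ⊨ φ → [] , i ⊨[ T ] close matrices k 0
  forth T i h = close⁺ matrices k []
    -- The range of `Π` is a subset of `T` with at most `k + 0` traces, so coherence passes `φ` down
    -- to it.
    (λ Π Π⊆T → translate⁺ em φ _
      (to (coherent T i) h (range Π) Π⊆T
        (subst (∣ range Π ∣≤_) (+-identityʳ k) (range-∣∣≤ Π))))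
    λ ()

  -- Coherence at T reduces to small S; coherence at range Π′ ⊇ S, where φ holds
  -- by the translated matrix, brings φ down to S.
  back′ : ∀ T i → k ≡ 0 ⊎ Satisfiable T → [] , i ⊨[ T ] close matrices k 0 → (T , i) ⊨ φ
  back′ T i hyp h = from (coherent T i) λ S S⊆T (ts , len , S⊆ts) →
    let m , Π′ , h′ , _ , T∩ts⊆ = close⁻ em matrices k [] ts len hyp h
    in to (coherent (range Π′) i) (translate⁻ em φ _ h′) S
         (λ s → T∩ts⊆ (S⊆T s) (S⊆ts s)) (ts , len , S⊆ts)

  back : ∀ T i → k ≡ 0 ⊎ Satisfiable T ⊎ ((∅ , i) ⊨ φ) →
         [] , i ⊨[ T ] close matrices k 0 → (T , i) ⊨ φ
  back T i (inj₁ k≡0)        h = back′ T i (inj₁ k≡0) h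
  back T i (inj₂ (inj₁ sat)) h = back′ T i (inj₂ sat) h
  -- A nonempty `T` supplies a trace to fill the quantifiers. An empty one is the empty team up to
  -- `≐`, where `φ` holds by assumption.
  back T i (inj₂ (inj₂ ∅⊨φ)) h with em {Satisfiable T}
  ... | yes sat = back′ T i (inj₂ sat) h
  ... | no ¬sat = ⊨-resp-≐ φ ((λ ()) , λ t∈ → ⊥-elim (¬sat (_ , t∈))) ∅⊨φ
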